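{- Let $G$ and $H$ be two impartial games such that $G \equiv^-_{\mathcal{I}} H$. Then $G\equiv^-_{\mathcal{D}} H$.
   Context: A game is a finite two-player combinatorial game, defined recursively by $G=\{G^{\mathbf L}\mid G^{\mathbf R}\}$, where $G^{\mathbf L}$ and $G^{\mathbf R}$ are the finite sets of Left options and Right options, which are themselves games. The game $0=\{\cdot\mid\cdot\}$ has no options. The sum is $G+H=\{G^{\mathbf L}+H,\,G+H^{\mathbf L}\mid G^{\mathbf R}+H,\,G+H^{\mathbf R}\}$. Left and Right alternate moves. Under misère play, a player who cannot move on their turn wins. The misère outcome $o^-(G)$ is $\mathcal L$ (Left wins whoever starts), $\mathcal R$ (Right wins whoever starts), $\mathcal N$ (the first player wins) or $\mathcal P$ (the second player wins). Outcomes are partially ordered by $\mathcal R<\mathcal N<\mathcal L$ and $\mathcal R<\mathcal P<\mathcal L$, with $\mathcal N$ and $\mathcal P$ incomparable. For a set $\mathcal U$ of games and games $G,H$ (not necessarily in $\mathcal U$), $G\geqslant^-_{\mathcal U}H$ means $o^-(G+X)\geqslant o^-(H+X)$ for every $X\in\mathcal U$, and $G\equiv^-_{\mathcal U}H$ means $G\geqslant^-_{\mathcal U}H$ and $H\geqslant^-_{\mathcal U}G$. A game is dicot if it is $0$, or if it has both Left and Right options and all of them are dicot. A game is impartial if its set of Left options equals its set of Right options and all these options, if any, are impartial. $\mathcal D$ is the set of all dicot games and $\mathcal I$ is the set of all impartial games. -}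

module Defs where

open import Level using (0ℓ)
open import Data.Nat using (NonZero; _≟_)
open import Data.Fin using (Fin)
open import Data.Fin.Properties using (any?)
open import Data.Vec.Functional using (Vector; _++_)
open import Data.Product using (∃; _×_)
open import Data.Sum using (_⊎_)
open import Relation.Nullary using (¬_; Dec; yes; no; ¬?; _⊎-dec_)
open import Relation.Unary using (Pred)
open import Relation.Binary.PropositionalEquality using (_≡_)

-- The two finite sets of options are presented as finite families, so a game
-- can have several presentations; `_≅_` below identifies them.
data Game : Set where
  game : ∀ {m n} (L : Vector Game m) (R : Vector Game n) → Game

infixl 6 _+_
infix  4 _≅_ _≥ᵒ_

-- Equality of games as hereditarily finite sets: order and repetition of
-- options are immaterial.
_≅_ : Game → Game → Set
game L R ≅ game L′ R′ =
    ((∀ i → ∃ λ j → L i ≅ L′ j) × (∀ j → ∃ λ i → L i ≅ L′ j))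
  × ((∀ i → ∃ λ j → R i ≅ R′ j) × (∀ j → ∃ λ i → R i ≅ R′ j))

_+_ : Game → Game → Game
G@(game L R) + H@(game L′ R′) =
  game ((λ i → L i + H) ++ (λ j → G + L′ j))
       ((λ i → R i + H) ++ (λ j → G + R′ j))

-- Misère play: a player to move wins if they have no move, or if some move
-- leads to a game that the opponent, now to move, does not win.
mutual
  LeftWinsFirst : Game → Set
  LeftWinsFirst (game {m} L R) = m ≡ 0 ⊎ ∃ λ i → ¬ RightWinsFirst (L i)

  RightWinsFirst : Game → Set
  RightWinsFirst (game {m} {n} L R) = n ≡ 0 ⊎ ∃ λ i → ¬ LeftWinsFirst (R i)

mutual
  leftWinsFirst? : ∀ G → Dec (LeftWinsFirst G)
  leftWinsFirst? (game {m} L R) =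
    (m ≟ 0) ⊎-dec any? (λ i → ¬? (rightWinsFirst? (L i)))

  rightWinsFirst? : ∀ G → Dec (RightWinsFirst G)
  rightWinsFirst? (game {m} {n} L R) =
    (n ≟ 0) ⊎-dec any? (λ i → ¬? (leftWinsFirst? (R i)))

data Outcome : Set where
  𝓛 𝓡 𝓝 𝓟 : Outcome

data _≥ᵒ_ : Outcome → Outcome → Set where
  ≥-refl : ∀ {o} → o ≥ᵒ o
  𝓛-max  : ∀ {o} → 𝓛 ≥ᵒ o
  𝓡-min  : ∀ {o} → o ≥ᵒ 𝓡

o⁻ : Game → Outcome
o⁻ G with leftWinsFirst? G | rightWinsFirst? G
... | yes _ | no  _ = 𝓛
... | no  _ | yes _ = 𝓡
... | yes _ | yes _ = 𝓝
... | no  _ | no  _ = 𝓟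

_≥⁻[_]_ : Game → Pred Game 0ℓ → Game → Set
G ≥⁻[ 𝓤 ] H = ∀ X → 𝓤 X → o⁻ (G + X) ≥ᵒ o⁻ (H + X)

_≡⁻[_]_ : Game → Pred Game 0ℓ → Game → Set
G ≡⁻[ 𝓤 ] H = G ≥⁻[ 𝓤 ] H × H ≥⁻[ 𝓤 ] G

infix 4 _≥⁻[_]_ _≡⁻[_]_

Dicot : Pred Game 0ℓ
Dicot (game {m} {n} L R) =
    (m ≡ 0 × n ≡ 0)
  ⊎ ((NonZero m × NonZero n) × (∀ i → Dicot (L i)) × (∀ j → Dicot (R j)))

-- The first component says that the sets of Left and Right options are equal.
Impartial : Pred Game 0ℓ
Impartial (game L R) =
    ((∀ i → ∃ λ j → L i ≅ R j) × (∀ j → ∃ λ i → L i ≅ R j))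
  × (∀ i → Impartial (L i)) × (∀ j → Impartial (R j))

{-# OPTIONS --safe #-}

-- Conway's theory of impartial misère play. Call G and H
-- unlinked when some option of G is equivalent to H or some option of H is
-- equivalent to G. Equivalence then amounts to: same outcome, no option of G
-- linked to H, and no option of H linked to G. For impartial test games this is
-- necessary because inequivalent games are explicitly separated by one.
-- It is sufficient even for dicot test games X: a winning move from G + X to
-- G′ + X is answered either by a move to an equivalent H′ + X, or by observing
-- that the reply from G′ to an equivalent of H is already lost for the opponent.
-- Dicots enter only when Left, say, has no move in G + X: then X = 0
-- and the outcomes of G and H decide.
module Submission where

open import Defs
open import Data.Fin using (Fin; zero; suc; splitAt; _↑ˡ_; _↑ʳ_)
open import Data.Fin.Properties using (any?; ¬Fin0)
import Data.Nat as ℕ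
open import Data.Nat using (zero; suc; _≟_)
open import Data.Nat.Properties using (m+n≡0⇒m≡0; m+n≡0⇒n≡0)
open import Data.Product using (∃; _×_; _,_; proj₁; proj₂; map₂; swap)
open import Data.Sum as Sum using (_⊎_; inj₁; inj₂; [_,_]′)
open import Data.Vec.Functional using (Vector; _++_; _∷_)
open import Data.Vec.Functional.Properties using (lookup-++ˡ; lookup-++ʳ)
open import Data.Vec.Functional.Relation.Unary.All using (All)
open import Data.Vec.Functional.Relation.Unary.All.Properties using (++⁺)
open import Data.Vec.Functional.Relation.Unary.Any using (Any)
open import Function using (_∘_)
open import Relation.Binary.PropositionalEquality using (_≡_; refl; sym; subst)
open import Relation.Nullary
  using (¬_; Dec; yes; no; ¬?; _⊎-dec_; _×-dec_; contradiction; decidable-stable)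

-- Finite families and moves in a sum

any-++ˡ : ∀ {A : Set} (P : A → Set) {m n} (xs : Vector A m) (ys : Vector A n) →
          Any P xs → Any P (xs ++ ys)
any-++ˡ P {n = n} xs ys (i , p) =
  i ↑ˡ n , subst P (sym (lookup-++ˡ xs ys i)) p

any-++ʳ : ∀ {A : Set} (P : A → Set) {m n} (xs : Vector A m) (ys : Vector A n) →
          Any P ys → Any P (xs ++ ys)
any-++ʳ P {m} xs ys (j , p) =
  m ↑ʳ j , subst P (sym (lookup-++ʳ xs ys j)) p

any-++⁻ : ∀ {A : Set} (P : A → Set) {m n} (xs : Vector A m) (ys : Vector A n) →
          Any P (xs ++ ys) → Any P xs ⊎ Any P ys
any-++⁻ P {m} xs ys (k , p) with splitAt m k
... | inj₁ i = inj₁ (i , p)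
... | inj₂ j = inj₂ (j , p)

-- Finiteness turns pointwise alternatives into a witness or a uniform family; neither `A` nor `B`
-- has to be decidable.
search : ∀ {n} {A B : Fin n → Set} → (∀ i → A i ⊎ B i) → ∃ A ⊎ (∀ i → B i)
search {zero}  f = inj₂ λ ()
search {suc n} f with f zero | search (f ∘ suc)
... | inj₁ a | _            = inj₁ (zero , a)
... | inj₂ _ | inj₁ (i , a) = inj₁ (suc i , a)
... | inj₂ b | inj₂ bs      = inj₂ λ { zero → b ; (suc i) → bs i }

module _ {A : Set} (P : A → Set) {m n} (xs : Vector A m) (ys : Vector A n) where

  -- Having no move in a sum means having none in either summand, so the misère clause for a stuck
  -- player becomes a condition on both components.
  firstWin⁺ : (m ≡ 0 × n ≡ 0) ⊎ Any P xs ⊎ Any P ys →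
              m ℕ.+ n ≡ 0 ⊎ Any P (xs ++ ys)
  firstWin⁺ (inj₁ (refl , refl)) = inj₁ refl
  firstWin⁺ (inj₂ (inj₁ p))      = inj₂ (any-++ˡ P xs ys p)
  firstWin⁺ (inj₂ (inj₂ p))      = inj₂ (any-++ʳ P xs ys p)

  firstWin⁻ : m ℕ.+ n ≡ 0 ⊎ Any P (xs ++ ys) →
              (m ≡ 0 × n ≡ 0) ⊎ Any P xs ⊎ Any P ys
  firstWin⁻ (inj₁ e) = inj₁ (m+n≡0⇒m≡0 m e , m+n≡0⇒n≡0 m e)
  firstWin⁻ (inj₂ p) = inj₂ (any-++⁻ P xs ys p)

-- Equality of games and invariance of outcomes

≅-refl : ∀ G → G ≅ G
≅-refl (game L R) =
    ((λ i → i , ≅-refl (L i)) , (λ i → i , ≅-refl (L i)))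
  , ((λ i → i , ≅-refl (R i)) , (λ i → i , ≅-refl (R i)))

≅-sym : ∀ G H → G ≅ H → H ≅ G
≅-sym (game L R) (game L′ R′) ((l , l′) , (r , r′)) =
    ((λ j → map₂ (≅-sym (L _) (L′ j)) (l′ j)) , (λ i → map₂ (≅-sym (L i) (L′ _)) (l i)))
  , ((λ j → map₂ (≅-sym (R _) (R′ j)) (r′ j)) , (λ i → map₂ (≅-sym (R i) (R′ _)) (r i)))

≅-trans : ∀ G H K → G ≅ H → H ≅ K → G ≅ K
≅-trans (game L R) (game L′ R′) (game L″ R″)
        ((l₁ , l₁′) , (r₁ , r₁′)) ((l₂ , l₂′) , (r₂ , r₂′)) =
    ( (λ i → let j , p = l₁ i ; k , q = l₂ j in k , ≅-trans (L i) (L′ j) (L″ k) p q)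
    , (λ k → let j , q = l₂′ k ; i , p = l₁′ j in i , ≅-trans (L i) (L′ j) (L″ k) p q))
  , ( (λ i → let j , p = r₁ i ; k , q = r₂ j in k , ≅-trans (R i) (R′ j) (R″ k) p q)
    , (λ k → let j , q = r₂′ k ; i , p = r₁′ j in i , ≅-trans (R i) (R′ j) (R″ k) p q))

module _ {A : Set} {_∼_ : A → A → Set} {m n m′ n′}
         (xs : Vector A m) (ys : Vector A n) (xs′ : Vector A m′) (ys′ : Vector A n′) where

  -- With the relation as a parameter, `_≅_` and its converse give the two inclusions of a set
  -- equality.
  cover-++ : (∀ i → ∃ λ j → xs i ∼ xs′ j) → (∀ i → ∃ λ j → ys i ∼ ys′ j) →
             ∀ i → ∃ λ j → (xs ++ ys) i ∼ (xs′ ++ ys′) j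
  cover-++ p q = ++⁺ (λ x → Any (x ∼_) (xs′ ++ ys′))
                     (λ i → any-++ˡ (xs i ∼_) xs′ ys′ (p i)) (λ i → any-++ʳ (ys i ∼_) xs′ ys′ (q i))

+-cong : ∀ A B X Y → A ≅ B → X ≅ Y → A + X ≅ B + Y
+-cong A@(game L R) B@(game L′ R′) X@(game M S) Y@(game M′ S′)
       p@((l , l′) , (r , r′)) q@((k , k′) , (s , s′)) =
    ( cover-++ {_∼_ = _≅_} _ _ _ _
        (λ i → map₂ (λ e → +-cong (L i) (L′ _) X Y e q) (l i))
        (λ i → map₂ (λ e → +-cong A B (M i) (M′ _) p e) (k i))
    , cover-++ {_∼_ = λ x y → y ≅ x} _ _ _ _
        (λ j → map₂ (λ e → +-cong (L _) (L′ j) X Y e q) (l′ j))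
        (λ j → map₂ (λ e → +-cong A B (M _) (M′ j) p e) (k′ j)))
  , ( cover-++ {_∼_ = _≅_} _ _ _ _
        (λ i → map₂ (λ e → +-cong (R i) (R′ _) X Y e q) (r i))
        (λ i → map₂ (λ e → +-cong A B (S i) (S′ _) p e) (s i))
    , cover-++ {_∼_ = λ x y → y ≅ x} _ _ _ _
        (λ j → map₂ (λ e → +-cong (R _) (R′ j) X Y e q) (r′ j))
        (λ j → map₂ (λ e → +-cong A B (S _) (S′ j) p e) (s′ j)))

covered-by-empty : ∀ {m n} {P : Fin m → Fin n → Set} →
                  (∀ j → ∃ λ i → P i j) → m ≡ 0 → n ≡ 0
covered-by-empty {n = zero}  c refl = refl
covered-by-empty {n = suc n} c refl = contradiction (proj₁ (c zero)) ¬Fin0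

mutual
  leftWinsFirst-≅ : ∀ A B → A ≅ B → LeftWinsFirst A → LeftWinsFirst B
  leftWinsFirst-≅ (game _ _) (game _ _) ((_ , l′) , _) (inj₁ e) = inj₁ (covered-by-empty l′ e)
  leftWinsFirst-≅ (game L _) (game L′ _) ((l , _) , _) (inj₂ (i , w)) =
    let j , p = l i in inj₂ (j , w ∘ rightWinsFirst-≅ (L′ j) (L i) (≅-sym (L i) (L′ j) p))

  rightWinsFirst-≅ : ∀ A B → A ≅ B → RightWinsFirst A → RightWinsFirst B
  rightWinsFirst-≅ (game _ _) (game _ _) (_ , (_ , r′)) (inj₁ e) = inj₁ (covered-by-empty r′ e)
  rightWinsFirst-≅ (game _ R) (game _ R′) (_ , (r , _)) (inj₂ (i , w)) =
    let j , p = r i in inj₂ (j , w ∘ leftWinsFirst-≅ (R′ j) (R i) (≅-sym (R i) (R′ j) p))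

-- An outcome records who wins for each choice of starter, and the order on outcomes is the product
-- order: increasing in Left's wins, decreasing in Right's.
o⁻-mono : ∀ A B → (LeftWinsFirst B → LeftWinsFirst A) →
          (RightWinsFirst A → RightWinsFirst B) → o⁻ A ≥ᵒ o⁻ B
o⁻-mono A B f g
  with leftWinsFirst? A | rightWinsFirst? A | leftWinsFirst? B | rightWinsFirst? B
... | yes _ | no  _ | _     | _     = 𝓛-max
... | _     | _     | no  _ | yes _ = 𝓡-min
... | no ¬a | _     | yes b | _     = contradiction (f b) ¬a
... | _     | yes a | _     | no ¬b = contradiction (g a) ¬b
... | yes _ | yes _ | yes _ | yes _ = ≥-refl
... | no  _ | no  _ | no  _ | no  _ = ≥-refl

≥ᵒ⇒leftWinsFirst : ∀ A B → o⁻ A ≥ᵒ o⁻ B → LeftWinsFirst B → LeftWinsFirst A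
≥ᵒ⇒leftWinsFirst A B o b
  with leftWinsFirst? A | rightWinsFirst? A | leftWinsFirst? B | rightWinsFirst? B
≥ᵒ⇒leftWinsFirst A B o  b | yes a | _     | _     | _     = a
≥ᵒ⇒leftWinsFirst A B o  b | no _  | _     | no ¬b | _     = contradiction b ¬b
≥ᵒ⇒leftWinsFirst A B () b | no _  | yes _ | yes _ | yes _
≥ᵒ⇒leftWinsFirst A B () b | no _  | yes _ | yes _ | no _
≥ᵒ⇒leftWinsFirst A B () b | no _  | no _  | yes _ | yes _
≥ᵒ⇒leftWinsFirst A B () b | no _  | no _  | yes _ | no _

-- Impartial games as trees with one family of options

data Imp : Set where
  node : ∀ {n} → Vector Imp n → Imp

ι : Imp → Game
ι (node v) = game (ι ∘ v) (ι ∘ v)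

ι-impartial : ∀ g → Impartial (ι g)
ι-impartial (node v) =
    ((λ i → i , ≅-refl (ι (v i))) , (λ i → i , ≅-refl (ι (v i))))
  , (ι-impartial ∘ v) , (ι-impartial ∘ v)

toImp : Game → Imp
toImp (game L R) = node (toImp ∘ L)

-- `toImp` keeps the Left options only; impartiality matches each Right option with a Left one,
-- whose image then serves for both.
≅-ι-toImp : ∀ G → Impartial G → G ≅ ι (toImp G)
≅-ι-toImp (game L R) ((l , r) , impL , _) =
    ((λ i → i , left i) , (λ i → i , left i))
  , ( (λ j → let i , p = r j in i , right i j p)
    , (λ i → let j , p = l i in j , right i j p))
  where
  left : ∀ i → L i ≅ ι (toImp (L i))
  left i = ≅-ι-toImp (L i) (impL i)

  right : ∀ i j → L i ≅ R j → R j ≅ ι (toImp (L i))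
  right i j p =
    ≅-trans (R j) (L i) (ι (toImp (L i))) (≅-sym (L i) (R j) p) (left i)

-- The misère win of the player to move in the sum of `g` and `h`, stated on the pair so that
-- neither the sum nor the two players have to be mentioned.
FirstWins : Imp → Imp → Set
FirstWins g@(node {m} v) h@(node {n} w) =
  (m ≡ 0 × n ≡ 0) ⊎ (∃ λ i → ¬ FirstWins (v i) h) ⊎ (∃ λ j → ¬ FirstWins g (w j))

firstWins? : ∀ g h → Dec (FirstWins g h)
firstWins? g@(node {m} v) h@(node {n} w) =
  ((m ≟ 0) ×-dec (n ≟ 0))
    ⊎-dec (any? (λ i → ¬? (firstWins? (v i) h)) ⊎-dec any? (λ j → ¬? (firstWins? g (w j))))

moveˡ : ∀ {m} {v : Vector Imp m} h → Any (λ g → ¬ FirstWins g h) v → FirstWins (node v) h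
moveˡ (node _) = inj₂ ∘ inj₁

moveʳ : ∀ {n} g {w : Vector Imp n} → Any (λ h → ¬ FirstWins g h) w → FirstWins g (node w)
moveʳ (node _) = inj₂ ∘ inj₂

-- A player with no move wins, so a P-position must have some option; this is the first hypothesis.
secondWins : ∀ {m n} {v : Vector Imp m} {w : Vector Imp n} → ¬ (m ≡ 0 × n ≡ 0) →
             All (λ g → FirstWins g (node w)) v → All (FirstWins (node v)) w →
             ¬ FirstWins (node v) (node w)
secondWins ne _ _ (inj₁ e)              = ne e
secondWins _  f _ (inj₂ (inj₁ (i , p))) = p (f i)
secondWins _  _ f (inj₂ (inj₂ (j , p))) = p (f j)

mutual
  -- A move passes the turn and negates the claim, so both directions for both players are proved
  -- together.
  firstWins⇒left : ∀ g h → FirstWins g h → LeftWinsFirst (ι g + ι h)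
  firstWins⇒left g@(node v) h@(node w) = firstWin⁺ (¬_ ∘ RightWinsFirst) _ _ ∘
    Sum.map₂ (Sum.map (map₂ (λ p → p ∘ right⇒firstWins (v _) h))
                      (map₂ (λ p → p ∘ right⇒firstWins g (w _))))

  left⇒firstWins : ∀ g h → LeftWinsFirst (ι g + ι h) → FirstWins g h
  left⇒firstWins g@(node v) h@(node w) =
    Sum.map₂ (Sum.map (map₂ (λ p → p ∘ firstWins⇒right (v _) h))
                      (map₂ (λ p → p ∘ firstWins⇒right g (w _))))
    ∘ firstWin⁻ (¬_ ∘ RightWinsFirst) _ _

  firstWins⇒right : ∀ g h → FirstWins g h → RightWinsFirst (ι g + ι h)
  firstWins⇒right g@(node v) h@(node w) = firstWin⁺ (¬_ ∘ LeftWinsFirst) _ _ ∘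
    Sum.map₂ (Sum.map (map₂ (λ p → p ∘ left⇒firstWins (v _) h))
                      (map₂ (λ p → p ∘ left⇒firstWins g (w _))))

  right⇒firstWins : ∀ g h → RightWinsFirst (ι g + ι h) → FirstWins g h
  right⇒firstWins g@(node v) h@(node w) =
    Sum.map₂ (Sum.map (map₂ (λ p → p ∘ firstWins⇒left (v _) h))
                      (map₂ (λ p → p ∘ firstWins⇒left g (w _))))
    ∘ firstWin⁻ (¬_ ∘ LeftWinsFirst) _ _

-- Mates

∅ star : Imp
∅ = node {0} λ ()
star = node {1} λ _ → ∅

-- The only move leaves the empty sum, which the opponent, being stuck, wins.
empty+star : ∀ (v : Vector Imp 0) → ¬ FirstWins (node v) star
empty+star v = secondWins (λ ()) (λ ()) (λ _ → inj₁ (refl , refl))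

-- Conway's mate. A copy of `g` would not do at the leaves, where the empty sum is an N-position;
-- `star` repairs the parity.
mate : Imp → Imp
mate (node {zero}  _) = star
mate (node {suc _} v) = node (mate ∘ v)

-- The second player answers each move by the matching move in the other component, until one of
-- them is empty and the other is `star`.
¬firstWins-mate : ∀ g → ¬ FirstWins g (mate g)
¬firstWins-mate (node {zero}  v) = empty+star v
¬firstWins-mate (node {suc _} v) =
  secondWins (λ ())
    (λ i → moveʳ (v i) (i , ¬firstWins-mate (v i)))
    (λ i → moveˡ (mate (v i)) (i , ¬firstWins-mate (v i)))

-- Conway's equivalence and separating tests

infix 4 _~_
mutual
  _~_ : Imp → Imp → Set
  g@(node v) ~ h@(node w) =
      ((FirstWins g ∅ → FirstWins h ∅) × (FirstWins h ∅ → FirstWins g ∅))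
    × ((∀ i → Unlinked (v i) h) × (∀ j → Unlinked (w j) g))

  -- Stated positively, as a witness that no common P-position partner can exist; the witness later
  -- supplies a move.
  Unlinked : Imp → Imp → Set
  Unlinked g@(node v) h@(node w) = (∃ λ i → v i ~ h) ⊎ (∃ λ j → w j ~ g)

~-sym : ∀ g h → g ~ h → h ~ g
~-sym (node _) (node _) (o , u) = swap o , swap u

Separated : Imp → Imp → Set
Separated g h = ∃ λ t → ¬ FirstWins g t × FirstWins h t

Linked : Imp → Imp → Set
Linked g h = ∃ λ t → ¬ FirstWins g t × ¬ FirstWins h t

-- Adjoining the mates of the options of h to t turns h + t into a P-position,
-- and the move to t makes g + t an N-position.
separated-swap : ∀ g h → Separated g h → Separated h g
separated-swap g (node w) (t , ¬gt , ht) =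
    node ts
  , secondWins (λ ())
      (λ j → moveʳ (w j) (suc j , ¬firstWins-mate (w j)))
      (λ { zero    → ht
         ; (suc j) → moveˡ (mate (w j)) (j , ¬firstWins-mate (w j)) })
  , moveʳ g {ts} (zero , ¬gt)
  where
  ts : Vector Imp _
  ts = t ∷ (mate ∘ w)

-- If t separates an option of g from h then g + t is an N-position, as is h + t;
-- so the game whose options are all these t links g to h.
linked-from-separated : ∀ {m n} (v : Vector Imp m) (w : Vector Imp n) →
  (∀ i → Separated (v i) (node w)) → (∀ j → Separated (w j) (node v)) →
  Linked (node v) (node w)
linked-from-separated {m} {n} v w a b with (m ≟ 0) ×-dec (n ≟ 0)
... | yes (refl , refl) = star , empty+star v , empty+star w
... | no ne =
    node (xs ++ ys)
  , secondWins (λ (e , e′) → ne (e , m+n≡0⇒n≡0 m e′))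
      (λ i → moveʳ (v i) (any-++ˡ (¬_ ∘ FirstWins (v i)) xs ys (i , proj₁ (proj₂ (a i)))))
      (++⁺ (FirstWins (node v)) (λ i → moveˡ (xs i) (i , proj₁ (proj₂ (a i))))
                                    (λ j → proj₂ (proj₂ (b j))))
  , secondWins (λ (e , e′) → ne (m+n≡0⇒m≡0 m e′ , e))
      (λ j → moveʳ (w j) (any-++ʳ (¬_ ∘ FirstWins (w j)) xs ys (j , proj₁ (proj₂ (b j)))))
      (++⁺ (FirstWins (node w)) (λ i → proj₂ (proj₂ (a i)))
                                    (λ j → moveˡ (ys j) (j , proj₁ (proj₂ (b j)))))
  where
  xs : Vector Imp m
  xs = proj₁ ∘ a
  ys : Vector Imp n
  ys = proj₁ ∘ b

mutual
  -- Each way for a clause of `_~_` to fail yields a separating test.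
  ~-or-separated : ∀ g h → (g ~ h) ⊎ Separated g h
  ~-or-separated g@(node v) h@(node w)
    with search (λ i → Sum.swap (unlinked-or-linked (v i) h))
       | search (λ j → Sum.swap (unlinked-or-linked (w j) g))
       | firstWins? g ∅ | firstWins? h ∅
  -- Both `v i` and `h` make P-positions with `t`; the move to `v i` makes `g` with `t` an
  -- N-position, so `t` separates `h` from `g`.
  ... | inj₁ (i , t , ¬g′t , ¬ht) | _ | _ | _ =
          inj₂ (separated-swap h g (t , ¬ht , moveˡ t (i , ¬g′t)))
  ... | _ | inj₁ (j , t , ¬h′t , ¬gt) | _ | _ = inj₂ (t , ¬gt , moveˡ t (j , ¬h′t))
  -- If the outcomes differ, the zero game is already a test.
  ... | _ | _ | no ¬p | yes q = inj₂ (∅ , ¬p , q)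
  ... | _ | _ | yes p | no ¬q = inj₂ (separated-swap h g (∅ , ¬q , p))
  ... | inj₂ u | inj₂ u′ | yes p | yes q = inj₁ (((λ _ → q) , (λ _ → p)) , u , u′)
  ... | inj₂ u | inj₂ u′ | no ¬p | no ¬q =
          inj₁ (((λ p → contradiction p ¬p) , (λ q → contradiction q ¬q)) , u , u′)

  unlinked-or-linked : ∀ g h → Unlinked g h ⊎ Linked g h
  unlinked-or-linked g@(node v) h@(node w)
    with search (λ i → ~-or-separated (v i) h) | search (λ j → ~-or-separated (w j) g)
  ... | inj₁ p | _      = inj₁ (inj₁ p)
  ... | _      | inj₁ p = inj₁ (inj₂ p)
  ... | inj₂ a | inj₂ b = inj₂ (linked-from-separated v w a b)

-- Equivalence against dicot test games

dicot-optionˡ : ∀ {m n} {L : Vector Game m} {R : Vector Game n} →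
                Dicot (game L R) → ∀ i → Dicot (L i)
dicot-optionˡ (inj₁ (refl , _))  ()
dicot-optionˡ (inj₂ (_ , d , _)) = d

dicot-optionʳ : ∀ {m n} {L : Vector Game m} {R : Vector Game n} →
                Dicot (game L R) → ∀ j → Dicot (R j)
dicot-optionʳ (inj₁ (_ , refl))  ()
dicot-optionʳ (inj₂ (_ , _ , d)) = d

dicot-noˡ : ∀ {n} {L : Vector Game 0} {R : Vector Game n} → Dicot (game L R) → n ≡ 0
dicot-noˡ (inj₁ (_ , e)) = e

dicot-noʳ : ∀ {m} {L : Vector Game m} {R : Vector Game 0} → Dicot (game L R) → m ≡ 0
dicot-noʳ (inj₁ (e , _)) = e
dicot-noʳ (inj₂ ((_ , ()) , _))

-- Functions out of `Fin 0` need not be definitionally equal, so an empty game is identified with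
-- `ι ∅` only up to `_≅_`.
∅-≅ : (L R : Vector Game 0) → ι ∅ ≅ game L R
∅-≅ L R = ((λ ()) , (λ ())) , ((λ ()) , (λ ()))

~⇒leftWinsFirst-∅ : ∀ {k} (v : Vector Imp k) h {m n} (L : Vector Game m) (R : Vector Game n) →
                    Dicot (game L R) → node v ~ h → k ≡ 0 × m ≡ 0 →
                    LeftWinsFirst (ι h + game L R)
~⇒leftWinsFirst-∅ v h@(node _) L R d ((o , _) , _) (refl , refl) with refl ← dicot-noˡ d =
  leftWinsFirst-≅ (ι h + ι ∅) (ι h + game L R)
    (+-cong (ι h) (ι h) (ι ∅) (game L R) (≅-refl (ι h)) (∅-≅ L R))
    (firstWins⇒left h ∅ (o (inj₁ (refl , refl))))

~⇒rightWinsFirst-∅ : ∀ {k} (v : Vector Imp k) h {m n} (L : Vector Game m) (R : Vector Game n) →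
                     Dicot (game L R) → node v ~ h → k ≡ 0 × n ≡ 0 →
                     RightWinsFirst (ι h + game L R)
~⇒rightWinsFirst-∅ v h@(node _) L R d ((o , _) , _) (refl , refl) with refl ← dicot-noʳ d =
  rightWinsFirst-≅ (ι h + ι ∅) (ι h + game L R)
    (+-cong (ι h) (ι h) (ι ∅) (game L R) (≅-refl (ι h)) (∅-≅ L R))
    (firstWins⇒right h ∅ (o (inj₁ (refl , refl))))

mutual
  ~⇒leftWinsFirst : ∀ g h X → Dicot X → g ~ h →
                    LeftWinsFirst (ι g + X) → LeftWinsFirst (ι h + X)
  ~⇒leftWinsFirst g@(node v) h@(node w) X@(game L R) d e@(_ , u , _) =
    [ ~⇒leftWinsFirst-∅ v h L R d e
    , [ (λ (i , p) → unlinked⇒leftWinsFirst (v i) h X d (u i) p)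
      -- A move in `X` is copied, and the induction continues with the roles of `g` and `h`
      -- exchanged.
      , (λ (j , p) → firstWin⁺ (¬_ ∘ RightWinsFirst) _ _ (inj₂ (inj₂
          (j , p ∘ ~⇒rightWinsFirst h g (L j) (dicot-optionˡ d j) (~-sym g h e)))))
      ]′
    ]′
    ∘ firstWin⁻ (¬_ ∘ RightWinsFirst) (λ i → ι (v i) + X) (λ j → ι g + L j)

  unlinked⇒leftWinsFirst : ∀ g h X → Dicot X → Unlinked g h →
                           ¬ RightWinsFirst (ι g + X) → LeftWinsFirst (ι h + X)
  unlinked⇒leftWinsFirst (node v) h@(node _) X@(game _ _) d (inj₁ (k , e)) p =
    -- Right's move to `v k` does not win, so it is not the case that Left loses there; decidability
    -- removes the double negation.
    ~⇒leftWinsFirst (v k) h X d e (decidable-stable (leftWinsFirst? (ι (v k) + X))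
      λ q → p (firstWin⁺ (¬_ ∘ LeftWinsFirst) _ _ (inj₂ (inj₁ (k , q)))))
  unlinked⇒leftWinsFirst g@(node _) (node w) X@(game _ _) d (inj₂ (j , e)) p =
    firstWin⁺ (¬_ ∘ RightWinsFirst) _ _
      (inj₂ (inj₁ (j , p ∘ ~⇒rightWinsFirst (w j) g X d e)))

  ~⇒rightWinsFirst : ∀ g h X → Dicot X → g ~ h →
                     RightWinsFirst (ι g + X) → RightWinsFirst (ι h + X)
  ~⇒rightWinsFirst g@(node v) h@(node w) X@(game L R) d e@(_ , u , _) =
    [ ~⇒rightWinsFirst-∅ v h L R d e
    , [ (λ (i , p) → unlinked⇒rightWinsFirst (v i) h X d (u i) p)
      , (λ (j , p) → firstWin⁺ (¬_ ∘ LeftWinsFirst) _ _ (inj₂ (inj₂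
          (j , p ∘ ~⇒leftWinsFirst h g (R j) (dicot-optionʳ d j) (~-sym g h e)))))
      ]′
    ]′
    ∘ firstWin⁻ (¬_ ∘ LeftWinsFirst) (λ i → ι (v i) + X) (λ j → ι g + R j)

  unlinked⇒rightWinsFirst : ∀ g h X → Dicot X → Unlinked g h →
                            ¬ LeftWinsFirst (ι g + X) → RightWinsFirst (ι h + X)
  unlinked⇒rightWinsFirst (node v) h@(node _) X@(game _ _) d (inj₁ (k , e)) p =
    ~⇒rightWinsFirst (v k) h X d e (decidable-stable (rightWinsFirst? (ι (v k) + X))
      λ q → p (firstWin⁺ (¬_ ∘ RightWinsFirst) _ _ (inj₂ (inj₁ (k , q)))))
  unlinked⇒rightWinsFirst g@(node _) (node w) X@(game _ _) d (inj₂ (j , e)) p =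
    firstWin⁺ (¬_ ∘ LeftWinsFirst) _ _
      (inj₂ (inj₁ (j , p ∘ ~⇒leftWinsFirst (w j) g X d e)))

-- Transfer to arbitrary presentations

≥⁻-from-~ : ∀ G H g h → G ≅ ι g → H ≅ ι h → g ~ h → G ≥⁻[ Dicot ] H
≥⁻-from-~ G H g h p q e X d = o⁻-mono (G + X) (H + X)
  (leftWinsFirst-≅ (ι g + X) (G + X) (≅-sym (G + X) (ι g + X) p+X)
    ∘ ~⇒leftWinsFirst h g X d (~-sym g h e)
    ∘ leftWinsFirst-≅ (H + X) (ι h + X) q+X)
  (rightWinsFirst-≅ (ι h + X) (H + X) (≅-sym (H + X) (ι h + X) q+X)
    ∘ ~⇒rightWinsFirst g h X d e
    ∘ rightWinsFirst-≅ (G + X) (ι g + X) p+X)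
  where
  p+X : G + X ≅ ι g + X
  p+X = +-cong G (ι g) X X p (≅-refl X)
  q+X : H + X ≅ ι h + X
  q+X = +-cong H (ι h) X X q (≅-refl X)

-- The test `ι t` is impartial, so the comparison would carry Left's win with `h` over to `g`, where
-- the first player loses.
≥⁻⇒¬separated : ∀ G H g h → G ≅ ι g → H ≅ ι h → G ≥⁻[ Impartial ] H → ¬ Separated g h
≥⁻⇒¬separated G H g h p q G≥H (t , ¬gt , ht) = ¬gt (left⇒firstWins g t
  (leftWinsFirst-≅ (G + ι t) (ι g + ι t) (+-cong G (ι g) (ι t) (ι t) p (≅-refl (ι t)))
    (≥ᵒ⇒leftWinsFirst (G + ι t) (H + ι t) (G≥H (ι t) (ι-impartial t))
      (leftWinsFirst-≅ (ι h + ι t) (H + ι t)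
        (+-cong (ι h) H (ι t) (ι t) (≅-sym H (ι h) q) (≅-refl (ι t)))
        (firstWins⇒left h t ht)))))

theorem4p6 : ∀ (G H : Game) → Impartial G → Impartial H → G ≡⁻[ Impartial ] H → G ≡⁻[ Dicot ] H
theorem4p6 G H impG impH (G≥H , _) with ~-or-separated (toImp G) (toImp H)
... | inj₁ e = ≥⁻-from-~ G H _ _ p q e , ≥⁻-from-~ H G _ _ q p (~-sym _ _ e)
  where
  p = ≅-ι-toImp G impG
  q = ≅-ι-toImp H impH
... | inj₂ s = contradiction s
  (≥⁻⇒¬separated G H _ _ (≅-ι-toImp G impG) (≅-ι-toImp H impH) G≥H)
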